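{- Let $\langle S,\mathsf{Act}_\tau,\rightarrow\rangle$ be a pLTS and let $E$ be its characteristic equation system for strong probabilistic bisimulation, consisting of one equation $X_s=\phi_s$ for each $s\in S$, where $$\phi_s:=\Big(\bigwedge_{s\xrightarrow{a}\Delta}\langle a\rangle X_\Delta\Big)\wedge\Big(\bigwedge_{a\in \mathsf{Act}_\tau}[a]\bigoplus_{s\xrightarrow{a}\Delta}X_\Delta\Big),\qquad X_\Delta:=\bigoplus_{s'\in\lceil\Delta\rceil}\Delta(s')\cdot{\downarrow}X_{s'},$$ interpreted with the strong semantics. Then, for all states $s,t\in S$: 1. $s\mathrel{\mathcal R}t$ for some strong probabilistic bisimulation $\mathcal R$ if and only if $\overline{t}\in\rho(X_s)$ for some post-fixpoint $\rho$ of $\mathcal F_E$. 2. In particular, $s\sim t$ if and only if $\overline{t}\in[\![\nu_E(X_s)]\!]$, i.e. $\nu_E(X_s)$ is a characteristic formula for $s$ with respect to strong probabilistic bisimilarity.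
   Context: Distributions. For a set $S$, $\mathcal D(S)$ is the set of discrete probability distributions $\Delta:S\to[0,1]$, $\sum_{s}\Delta(s)=1$; the support is $\lceil\Delta\rceil=\{s\mid\Delta(s)>0\}$; $\overline{s}$ is the point distribution at $s$; $\sum_{i\in I}p_i\cdot\Delta_i$ (with $p_i\ge0$, $\sum_{i\in I} p_i=1$) is the pointwise convex combination. pLTS. A (finite-state) probabilistic labelled transition system is a triple $\langle S,\mathsf{Act}_\tau,\rightarrow\rangle$ with $S$ a finite set of states, $\mathsf{Act}_\tau=\mathsf{Act}\cup\{\tau\}$ a set of external actions $\mathsf{Act}$ augmented with an internal action $\tau\notin\mathsf{Act}$, and $\rightarrow\ \subseteq S\times\mathsf{Act}_\tau\times\mathcal D(S)$. Write $s\xrightarrow{a}\Delta$ for $(s,a,\Delta)\in\rightarrow$. Lifting. For $\mathcal R\subseteq S\times S$, $\Delta\mathrel{\mathcal R^\dagger}\Theta$ holds iff there are a countable index set $I$, $p_i\geq 0$ with $\sum_{i\in I}p_i=1$, and states $s_i,t_i$ with $s_i\mathrel{\mathcal R}t_i$ for all $i\in I$, $\Delta=\sum_{i\in I} p_i\cdot\overline{s_i}$ and $\Theta=\sum_{i\in I} p_i\cdot\overline{t_i}$. For $\mathcal R\subseteq S\times\mathcal D(S)$, $\Delta\mathrel{\mathcal R^\dagger}\Theta$ holds iff there are a countable $I$, $p_i\geq 0$ with $\sum_{i\in I}p_i=1$, states $s_i$ and distributions $\Theta_i$ with $s_i\mathrel{\mathcal R}\Theta_i$ for all $i\in I$, $\Delta=\sum_{i\in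 I} p_i\cdot\overline{s_i}$ and $\Theta=\sum_{i\in I} p_i\cdot\Theta_i$. For distributions, $\Delta\xrightarrow{a}\Theta$ denotes $\Delta\mathrel{(\xrightarrow{a})^\dagger}\Theta$, the lifting of $\xrightarrow{a}\ \subseteq S\times\mathcal D(S)$. Bisimulation. $\mathcal R\subseteq S\times S$ is a strong probabilistic simulation if $s\mathrel{\mathcal R}t$, $a\in\mathsf{Act}_\tau$ and $s\xrightarrow{a}\Delta$ imply that there is some $\Theta$ with $\overline{t}\xrightarrow{a}\Theta$ and $\Delta\mathrel{\mathcal R^\dagger}\Theta$. If both $\mathcal R$ and $\mathcal R^{ -1}$ are strong probabilistic simulations, $\mathcal R$ is a strong probabilistic bisimulation. $s\sim t$ (strong probabilistic bisimilarity) iff $s\mathrel{\mathcal R}t$ for some strong probabilistic bisimulation $\mathcal R$. Formulae and strong semantics. $\mathsf{Var}$ is a countable set of variables, containing distinct variables $X_s$ for $s\in S$. An environment is a map $\rho:\mathsf{Var}\to\mathcal P(\mathcal D(S))$. Formulae are interpreted as sets of distributions: $[\![X]\!]_\rho=\rho(X)$; $[\![\bigwedge_{i\in I}\phi_i]\!]_\rho=\bigcap_{i\in I}[\![\phi_i]\!]_\rho$ (which is $\mathcal D(S)$ if $I=\emptyset$); $[\![\langle a\rangle\phi]\!]_\rho=\{\Delta\mid\exists\Delta':\Delta\xrightarrow{a}\Delta'\wedge\Delta'\in[\![\phi]\!]_\rho\}$; $[\![[a]\phi]\!]_\rho=\{\Delta\mid\forall\Delta':\Delta\xrightarrow{a}\Delta'\Rightarrow\Delta'\in[\![\phi]\!]_\rho\}$;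 $[\![\bigoplus_{i\in I}\phi_i]\!]_\rho=\{\Delta\mid\Delta=\sum_{i\in I}p_i\cdot\Delta_i\text{ for some }p_i\ge 0\text{ with }\sum_{i\in I}p_i=1,\text{ and }\Delta_i\in[\![\phi_i]\!]_\rho\text{ for all }i\in I\}$ (the empty set if $I=\emptyset$); $[\![\bigoplus_{i\in I}p_i\cdot\phi_i]\!]_\rho=\{\Delta\mid\Delta=\sum_{i\in I}p_i\cdot\Delta_i\text{ with }\Delta_i\in[\![\phi_i]\!]_\rho\text{ for all }i\in I\}$; $[\![{\downarrow}\phi]\!]_\rho=\{\Delta\mid\forall s\in\lceil\Delta\rceil:\overline{s}\in[\![\phi]\!]_\rho\}$. Equation systems. An equation system $E$ with equations $X_s=\phi_s$ is viewed as a function with $E(X_s)=\phi_s$ and $E(Y)=Y$ for every other variable $Y$. Environments are ordered pointwise: $\rho\sqsubseteq\rho'$ iff $\rho(X)\subseteq\rho'(X)$ for all $X\in\mathsf{Var}$. The equation functional is $\mathcal F_E(\rho)(X):=[\![E(X)]\!]_\rho$. A post-fixpoint of $\mathcal F_E$ is an environment $\rho$ with $\rho\sqsubseteq\mathcal F_E(\rho)$. The greatest solution is $\nu_E:=\bigsqcup\{\rho\mid\rho\sqsubseteq\mathcal F_E(\rho)\}$ (pointwise union), and $\nu_E(X)$ is also used as a formula, with $[\![\nu_E(X)]\!]:=\nu_E(X)$. "$\nu_E(X_s)$ is a characteristic formula for $s$ with respect to a relation $\mathcal R$" means: for all $t$, $s\mathrel{\mathcal R}t$ iff $\overline{t}\in[\![\nu_E(X_s)]\!]$.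 -}

module Defs where

open import Algebra.Bundles using (CommutativeRing)
open import Data.Bool.Base using (Bool; if_then_else_)
open import Data.Fin.Base using (Fin)
open import Data.Fin.Properties using (any?; inj⇒≟)
open import Data.List.Base using (List; []; _∷_; map; foldr)
open import Data.List.Relation.Unary.All using (All; []; _∷_)
open import Data.List.Relation.Unary.AllPairs using ([]; _∷_)
open import Data.List.Relation.Unary.Unique.Propositional using (Unique)
open import Data.Maybe.Base using (Maybe; nothing)
open import Data.Nat.Base using (ℕ)
import Data.Nat.Properties as ℕ
open import Data.Product.Base using (Σ-syntax; ∃; ∃₂; ∃-syntax; _×_; _,_; proj₁; proj₂)
open import Data.Refinement using (Refinement-syntax; value)
open import Data.Sum.Base using (_⊎_; inj₁; inj₂)
open import Function.Base using (_∘_; flip)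
open import Function.Bundles using (_↣_; _↔_; _⇔_; Inverse)
open import Function.Definitions using (Injective)
open import Function.Properties.Inverse using (↔⇒↣)
open import Level using (Level; 0ℓ; _⊔_) renaming (suc to lsuc)
open import Relation.Binary.Core using (Rel)
open import Relation.Binary.Definitions using (DecidableEquality)
open import Relation.Binary.PropositionalEquality.Core using (_≡_; _≢_; refl)
open import Relation.Binary.Structures using (IsTotalOrder)
import Relation.Binary.Construct.NonStrictToStrict as Strict
open import Relation.Nullary.Decidable.Core using (yes; no; does)
open import Relation.Nullary.Decidable using (via-injection)
open import Relation.Nullary.Negation.Core using (¬_; contradiction)
open import Relation.Unary using (Pred; _∈_; _⊆_)

1ℓ 2ℓ : Level
1ℓ = lsuc 0ℓ
2ℓ = lsuc 1ℓ

Countable : Set → Set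
Countable I = I ↣ ℕ

-- Classically these axioms (a Dedekind-complete ordered field) determine the
-- field of real numbers up to a unique isomorphism.
record CompleteOrderedField : Set₁ where
  field
    commutativeRing : CommutativeRing 0ℓ 0ℓ
  open CommutativeRing commutativeRing public
    renaming (refl to ≈-refl; sym to ≈-sym; trans to ≈-trans; reflexive to ≈-reflexive)
  infix 4 _≤_
  field
    _≤_          : Rel Carrier 0ℓ
    isTotalOrder : IsTotalOrder _≈_ _≤_
    0≉1          : ¬ (0# ≈ 1#)
    inverse      : ∀ x → ¬ (x ≈ 0#) → ∃[ y ] (x * y ≈ 1#)
    +-monoˡ-≤    : ∀ z {x y} → x ≤ y → x + z ≤ y + z
    *-nonNeg     : ∀ {x y} → 0# ≤ x → 0# ≤ y → 0# ≤ x * y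

  open IsTotalOrder isTotalOrder public
    using (total; antisym; ≤-resp-≈)
    renaming (reflexive to ≤-reflexive; refl to ≤-refl; trans to ≤-trans)

  open Strict _≈_ _≤_ public using (_<_)

  IsUpperBound : Pred Carrier 0ℓ → Pred Carrier 0ℓ
  IsUpperBound P x = ∀ y → y ∈ P → y ≤ x

  IsSupremum : Pred Carrier 0ℓ → Pred Carrier 0ℓ
  IsSupremum P x = IsUpperBound P x × (∀ z → IsUpperBound P z → x ≤ z)

  field
    complete : ∀ P → ∃ P → ∃ (IsUpperBound P) → ∃ (IsSupremum P)

module Distributions (ℝ : CompleteOrderedField) where
  open CompleteOrderedField ℝ

  private variable
    I S : Set

  ∑ : (I → Carrier) → List I → Carrier
  ∑ f is = foldr _+_ 0# (map f is)

  -- The sum of a nonnegative family over an arbitrary index set is the supremum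
  -- of its sums over finite subsets, i.e. over lists without repetitions.
  HasSum : (I → Carrier) → Carrier → Set
  HasSum {I} f = IsSupremum (λ y → Σ[ is ∈ List I ] Unique is × y ≈ ∑ f is)

  record 𝒟 (S : Set) : Set where
    field
      prob   : S → Carrier
      nonNeg : ∀ s → 0# ≤ prob s
      sum≈1  : HasSum prob 1#
  open 𝒟 public

  infix 4 _≈ᴰ_
  _≈ᴰ_ : Rel (𝒟 S) 0ℓ
  Δ ≈ᴰ Θ = ∀ s → prob Δ s ≈ prob Θ s

  Support : 𝒟 S → Pred S 0ℓ
  Support Δ s = 0# < prob Δ s

  -- The support as a type.  The proof of positivity is irrelevant, so that
  -- every state in the support occurs exactly once in sums over ⌈ Δ ⌉.
  ⌈_⌉ : 𝒟 S → Set
  ⌈_⌉ {S} Δ = [ s ∈ S ∣ Support Δ s ]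

  -- Δ = ∑ᵢ pᵢ · Δᵢ with pᵢ ≥ 0 and ∑ᵢ pᵢ = 1.
  record IsConvexCombination {I S : Set} (p : I → Carrier) (Δs : I → 𝒟 S) (Δ : 𝒟 S) : Set where
    field
      p-nonNeg  : ∀ i → 0# ≤ p i
      p-sum≈1   : HasSum p 1#
      pointwise : ∀ s → HasSum (λ i → p i * prob (Δs i) s) (prob Δ s)

  isSupremum-resp-≈ : ∀ {P x y} → x ≈ y → IsSupremum P x → IsSupremum P y
  isSupremum-resp-≈ x≈y (ub , least) =
      (λ z z∈P → ≤-trans (ub z z∈P) (≤-reflexive x≈y))
    , (λ z z-ub → ≤-trans (≤-reflexive (≈-sym x≈y)) (least z z-ub))

  isConvexCombination-resp-≈ᴰ : ∀ {p : I → Carrier} {Δs : I → 𝒟 S} {Δ Θ : 𝒟 S} → Δ ≈ᴰ Θ →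
                                IsConvexCombination p Δs Δ → IsConvexCombination p Δs Θ
  isConvexCombination-resp-≈ᴰ Δ≈Θ c = record
    { p-nonNeg  = p-nonNeg
    ; p-sum≈1   = p-sum≈1
    ; pointwise = λ s → isSupremum-resp-≈ (Δ≈Θ s) (pointwise s)
    } where open IsConvexCombination c

  module PointDistribution {S : Set} (_≟_ : DecidableEquality S) where

    indicator : S → S → Carrier
    indicator s t = if does (s ≟ t) then 1# else 0#

    private
      0≤1 : 0# ≤ 1#
      0≤1 with total 0# 1#
      ... | inj₁ 0≤1 = 0≤1
      ... | inj₂ 1≤0 = ≤-trans (*-nonNeg 0≤-1 0≤-1) (≤-reflexive -1*-1≈1)
        where
        0≤-1 : 0# ≤ - 1#
        0≤-1 = ≤-trans (≤-reflexive (≈-sym (-‿inverseʳ 1#)))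
                 (≤-trans (+-monoˡ-≤ (- 1#) 1≤0) (≤-reflexive (+-identityˡ _)))
        open import Algebra.Properties.Ring ring using (-1*x≈-x; -‿involutive)
        -1*-1≈1 : - 1# * - 1# ≈ 1#
        -1*-1≈1 = ≈-trans (-1*x≈-x (- 1#)) (-‿involutive 1#)

      indicator-nonNeg : ∀ s t → 0# ≤ indicator s t
      indicator-nonNeg s t with s ≟ t
      ... | yes _ = 0≤1
      ... | no  _ = ≤-refl

      ∑-absent : ∀ s ts → All (s ≢_) ts → ∑ (indicator s) ts ≈ 0#
      ∑-absent s []       []           = ≈-refl
      ∑-absent s (t ∷ ts) (s≢t ∷ s∉ts) with s ≟ t
      ... | yes s≡t = contradiction s≡t s≢t
      ... | no  _   = ≈-trans (+-identityˡ _) (∑-absent s ts s∉ts)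

      ∑-unique : ∀ s ts → Unique ts → ∑ (indicator s) ts ≤ 1#
      ∑-unique s []       []            = 0≤1
      ∑-unique s (t ∷ ts) (t∉ts ∷ uniq) with s ≟ t
      ... | yes refl = ≤-reflexive (≈-trans (+-congˡ (∑-absent s ts t∉ts)) (+-identityʳ 1#))
      ... | no  _    = ≤-trans (≤-reflexive (+-identityˡ _)) (∑-unique s ts uniq)

      ∑-self : ∀ s → 1# ≈ ∑ (indicator s) (s ∷ [])
      ∑-self s with s ≟ s
      ... | yes _   = ≈-sym (+-identityʳ 1#)
      ... | no  s≢s = contradiction refl s≢s

    point : S → 𝒟 S
    point s = record
      { prob   = indicator s
      ; nonNeg = indicator-nonNeg s
      ; sum≈1  =
            (λ { y (ts , uniq , y≈) → ≤-trans (≤-reflexive y≈) (∑-unique s ts uniq) })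
          , (λ z ub → ub 1# (s ∷ [] , [] ∷ [] , ∑-self s))
      }

pattern τ = nothing

record PLTS (ℝ : CompleteOrderedField) : Set₁ where
  open Distributions ℝ
  field
    S      : Set
    finite : ∃[ n ] (S ↔ Fin n)
    Act    : Set

  Actτ : Set
  Actτ = Maybe Act

  field
    _-[_]→_ : S → Actτ → 𝒟 S → Set
    →-resp-≈ᴰ : ∀ {s a Δ Θ} → Δ ≈ᴰ Θ → s -[ a ]→ Δ → s -[ a ]→ Θ

  _≟_ : DecidableEquality S
  _≟_ = inj⇒≟ (↔⇒↣ (proj₂ finite))

  open PointDistribution _≟_ public using (point)

-- A countable set of variables with distinct variables X s for the states s.
record Variables (S : Set) : Set₁ where
  field
    Var           : Set
    Var-countable : Countable Var
    X             : S → Var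
    X-injective   : Injective _≡_ _≡_ X

  _≟ⱽ_ : DecidableEquality Var
  _≟ⱽ_ = via-injection Var-countable ℕ._≟_

module Bisimulation {ℝ : CompleteOrderedField} (L : PLTS ℝ) where
  open CompleteOrderedField ℝ using (Carrier)
  open Distributions ℝ
  open PLTS L

  record Lift {r} (R : S → S → Set r) (Δ Θ : 𝒟 S) : Set (1ℓ ⊔ r) where
    field
      {I}       : Set
      countable : Countable I
      p         : I → Carrier
      s t       : I → S
      related   : ∀ i → R (s i) (t i)
      left      : IsConvexCombination p (point ∘ s) Δ
      right     : IsConvexCombination p (point ∘ t) Θ

  record Liftᴰ {r} (R : S → 𝒟 S → Set r) (Δ Θ : 𝒟 S) : Set (1ℓ ⊔ r) where
    field
      {I}       : Set
      countable : Countable I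
      p         : I → Carrier
      s         : I → S
      Θs        : I → 𝒟 S
      related   : ∀ i → R (s i) (Θs i)
      left      : IsConvexCombination p (point ∘ s) Δ
      right     : IsConvexCombination p Θs Θ

  _=[_]⇒_ : 𝒟 S → Actτ → 𝒟 S → Set₁
  Δ =[ a ]⇒ Θ = Liftᴰ (_-[ a ]→_) Δ Θ

  IsSimulation : Rel S 1ℓ → Set₁
  IsSimulation R = ∀ {s t a Δ} → R s t → s -[ a ]→ Δ →
                   ∃[ Θ ] (point t =[ a ]⇒ Θ) × Lift R Δ Θ

  IsBisimulation : Rel S 1ℓ → Set₁
  IsBisimulation R = IsSimulation R × IsSimulation (flip R)

  infix 4 _∼_
  _∼_ : Rel S 2ℓ
  s ∼ t = ∃[ R ] IsBisimulation R × R s t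

  IsCharacteristicFor : ∀ {ℓ r} → Pred (𝒟 S) ℓ → S → Rel S r → Set (ℓ ⊔ r)
  IsCharacteristicFor ⟦φ⟧ s R = ∀ t → R s t ⇔ point t ∈ ⟦φ⟧

module Logic {ℝ : CompleteOrderedField} (L : PLTS ℝ) (V : Variables (PLTS.S L)) where
  open CompleteOrderedField ℝ using (Carrier; ≈-sym; ≈-trans; ≤-trans; ≤-reflexive)
  open Distributions ℝ
  open PLTS L
  open Variables V
  open Bisimulation L

  infixr 6 _∧_
  infixr 7 ⟨_⟩_ [_]_ ↓_

  data Formula : Set₁ where
    var   : Var → Formula
    ⋀     : {I : Set} → (I → Formula) → Formula
    ⟨_⟩_  : Actτ → Formula → Formula
    [_]_  : Actτ → Formula → Formula
    ⨁     : {I : Set} → (I → Formula) → Formula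
    ⨁[_]· : {I : Set} → (I → Carrier) → (I → Formula) → Formula
    ↓_    : Formula → Formula

  _∧_ : Formula → Formula → Formula
  φ ∧ ψ = ⋀ {Bool} (λ b → if b then φ else ψ)

  record Env (ℓ : Level) : Set (1ℓ ⊔ lsuc ℓ) where
    infix 9 _⟨_⟩ᵉ
    field
      _⟨_⟩ᵉ : Var → Pred (𝒟 S) ℓ
      resp-≈ᴰ : ∀ Y {Δ Θ} → Δ ≈ᴰ Θ → Δ ∈ _⟨_⟩ᵉ Y → Θ ∈ _⟨_⟩ᵉ Y
  open Env public

  infix 4 _⊑_
  _⊑_ : ∀ {ℓ} → Env ℓ → Env ℓ → Set ℓ
  ρ ⊑ ρ′ = ∀ Y → ρ ⟨ Y ⟩ᵉ ⊆ ρ′ ⟨ Y ⟩ᵉ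

  ⟦_⟧ : Formula → Env 1ℓ → Pred (𝒟 S) 1ℓ
  ⟦ var Y       ⟧ ρ Δ = Δ ∈ ρ ⟨ Y ⟩ᵉ
  ⟦ ⋀ φ         ⟧ ρ Δ = ∀ i → Δ ∈ ⟦ φ i ⟧ ρ
  ⟦ ⟨ a ⟩ φ     ⟧ ρ Δ = ∃[ Δ′ ] (Δ =[ a ]⇒ Δ′) × Δ′ ∈ ⟦ φ ⟧ ρ
  ⟦ [ a ] φ     ⟧ ρ Δ = ∀ Δ′ → Δ =[ a ]⇒ Δ′ → Δ′ ∈ ⟦ φ ⟧ ρ
  ⟦ ⨁ φ         ⟧ ρ Δ = ∃₂ λ p Δs → IsConvexCombination p Δs Δ × (∀ i → Δs i ∈ ⟦ φ i ⟧ ρ)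
  ⟦ ⨁[ p ]· φ   ⟧ ρ Δ = ∃ λ Δs → IsConvexCombination p Δs Δ × (∀ i → Δs i ∈ ⟦ φ i ⟧ ρ)
  ⟦ ↓ φ         ⟧ ρ Δ = ∀ s → s ∈ Support Δ → point s ∈ ⟦ φ ⟧ ρ

  =⇒-resp-≈ᴰ : ∀ {Δ Θ Δ′ a} → Δ ≈ᴰ Θ → Δ =[ a ]⇒ Δ′ → Θ =[ a ]⇒ Δ′
  =⇒-resp-≈ᴰ Δ≈Θ l = record
    { countable = countable ; p = p ; s = s ; Θs = Θs ; related = related
    ; left = isConvexCombination-resp-≈ᴰ Δ≈Θ left ; right = right
    } where open Liftᴰ l

  ⟦⟧-resp-≈ᴰ : ∀ φ ρ {Δ Θ} → Δ ≈ᴰ Θ → Δ ∈ ⟦ φ ⟧ ρ → Θ ∈ ⟦ φ ⟧ ρ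
  ⟦⟧-resp-≈ᴰ (var Y)     ρ Δ≈Θ h = resp-≈ᴰ ρ Y Δ≈Θ h
  ⟦⟧-resp-≈ᴰ (⋀ φ)       ρ Δ≈Θ h = λ i → ⟦⟧-resp-≈ᴰ (φ i) ρ Δ≈Θ (h i)
  ⟦⟧-resp-≈ᴰ (⟨ a ⟩ φ)   ρ Δ≈Θ (Δ′ , tr , h) = Δ′ , =⇒-resp-≈ᴰ Δ≈Θ tr , h
  ⟦⟧-resp-≈ᴰ ([ a ] φ)   ρ Δ≈Θ h = λ Δ′ tr → h Δ′ (=⇒-resp-≈ᴰ (λ s → ≈-sym (Δ≈Θ s)) tr)
  ⟦⟧-resp-≈ᴰ (⨁ φ)       ρ Δ≈Θ (p , Δs , c , h) = p , Δs , isConvexCombination-resp-≈ᴰ Δ≈Θ c , h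
  ⟦⟧-resp-≈ᴰ (⨁[ p ]· φ) ρ Δ≈Θ (Δs , c , h) = Δs , isConvexCombination-resp-≈ᴰ Δ≈Θ c , h
  ⟦⟧-resp-≈ᴰ (↓ φ)       ρ Δ≈Θ h = λ { s (0≤ , 0≉) → h s
    ( ≤-trans 0≤ (≤-reflexive (≈-sym (Δ≈Θ s)))
    , λ 0≈ → 0≉ (≈-trans 0≈ (Δ≈Θ s)) ) }

  EquationSystem : Set₁
  EquationSystem = Var → Formula

  -- The equations X s = φ s, with Y = Y for every other variable Y.
  equations : (S → Formula) → EquationSystem
  equations φ Y with any? (λ i → X (Inverse.from (proj₂ finite) i) ≟ⱽ Y)
  ... | yes (i , _) = φ (Inverse.from (proj₂ finite) i)
  ... | no  _       = var Y

  ℱ : EquationSystem → Env 1ℓ → Env 1ℓ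
  ℱ E ρ = record
    { _⟨_⟩ᵉ   = λ Y → ⟦ E Y ⟧ ρ
    ; resp-≈ᴰ = λ Y → ⟦⟧-resp-≈ᴰ (E Y) ρ
    }

  IsPostFixpoint : EquationSystem → Pred (Env 1ℓ) 1ℓ
  IsPostFixpoint E ρ = ρ ⊑ ℱ E ρ

  -- A union over all environments with values in Set₁ has values in Set₂.
  ⨆ : Pred (Env 1ℓ) 1ℓ → Env 2ℓ
  ⨆ P = record
    { _⟨_⟩ᵉ   = λ Y Δ → ∃[ ρ ] ρ ∈ P × Δ ∈ ρ ⟨ Y ⟩ᵉ
    ; resp-≈ᴰ = λ { Y Δ≈Θ (ρ , ρ∈P , h) → ρ , ρ∈P , resp-≈ᴰ ρ Y Δ≈Θ h }
    }

  ν : EquationSystem → Env 2ℓ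
  ν E = ⨆ (IsPostFixpoint E)

  X[_] : 𝒟 S → Formula
  X[ Δ ] = ⨁[_]· {⌈ Δ ⌉} (λ s′ → prob Δ (value s′)) (λ s′ → ↓ var (X (value s′)))

  characteristic : S → Formula
  characteristic s =
      ⋀ {∃₂ λ a Δ → s -[ a ]→ Δ} (λ { (a , Δ , _) → ⟨ a ⟩ X[ Δ ] })
    ∧ ⋀ {Actτ} (λ a → [ a ] ⨁ {∃[ Δ ] (s -[ a ]→ Δ)} (λ { (Δ , _) → X[ Δ ] }))

  characteristicSystem : EquationSystem
  characteristicSystem = equations characteristic

{-# OPTIONS --safe #-}

-- Δ R† Θ holds iff there is a coupling: a matrix of nonnegative weights with marginals Δ and Θ
-- that vanishes off R.  Couplings are closed under convex combinations, and conversely a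
-- coupling of ∑ⱼ qⱼ · Δⱼ with Θ splits Θ into ∑ⱼ qⱼ · Θⱼ with Δⱼ coupled to Θⱼ.  For Δ = ∑ₛ Δ(s) · s̄
-- this shows that Θ satisfies X_Δ under ρ iff Δ is coupled to Θ by { (s , t) | t̄ ∈ ρ(X_s) }.  The
-- diamonds then say that this relation is a simulation.  For the boxes, a transition of t to
-- Θ = ∑ₖ pₖ · Θₖ, with k ranging over the transitions s –a→ Δₖ and Θₖ coupled to Δₖ, is answered
-- by ∑ₖ pₖ · Δₖ; conversely an answer of s is regrouped by the transitions of s, and splitting
-- its coupling with Θ gives the Θₖ.
--
-- Excluded middle is available for all types rather than for propositions only, so it also
-- acts as a choice operator.
module Submission where

open import Defs
open import Axiom.ExcludedMiddle using (ExcludedMiddle)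
open import Data.Bool.Base using (true; false)
open import Data.Empty using (⊥-elim)
open import Data.Fin.Base using (toℕ)
import Data.Fin.Properties as Fin
open import Data.Irrelevant using ([_])
open import Data.List.Base using (List; []; _∷_; _++_; deduplicate; lookup)
open import Data.List.Membership.Propositional using () renaming (_∈_ to _∈ˡ_; _∉_ to _∉ˡ_)
open import Data.List.Membership.Propositional.Properties using (∈-∃++; ∈-deduplicate⁺; ∈-++⁺ˡ; ∈-++⁺ʳ; ∈-++⁻)
open import Data.List.Relation.Binary.Subset.Propositional using () renaming (_⊆_ to _⊆ˡ_)
open import Data.List.Relation.Unary.All using ([]; _∷_)
import Data.List.Relation.Unary.All as All
open import Data.List.Relation.Unary.All.Properties using (¬Any⇒All¬)
open import Data.List.Relation.Unary.AllPairs using ([]; _∷_)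
open import Data.List.Relation.Unary.Any using (here; there; index)
open import Data.List.Relation.Unary.Any.Properties using (lookup-index)
open import Data.List.Relation.Unary.Unique.Propositional using (Unique)
open import Data.List.Relation.Unary.Unique.DecPropositional.Properties using (deduplicate-!)
open import Data.Nat.Base as ℕ using (ℕ; zero; suc)
import Data.Nat.Properties as ℕ
open import Data.Product.Base using (Σ-syntax; ∃; ∃₂; ∃-syntax; _×_; _,_; proj₁; proj₂; uncurry)
open import Data.Product.Function.NonDependent.Propositional using (_×-↔_)
open import Data.Refinement using (Refinement-syntax; value; _,_)
open import Data.Sum.Base using (inj₁; inj₂)
open import Data.Unit.Base using (⊤; tt)
import Data.Unit.Properties as ⊤
open import Function.Base using (_∘_; flip)
open import Function.Bundles using (_⇔_; mk⇔; mk↣; Inverse)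
open import Function.Construct.Composition using (_↣-∘_; _↔-∘_)
open import Function.Definitions using (Injective)
open import Function.Properties.Inverse using (↔⇒↣; ↔-sym)
open import Level using (0ℓ; lift; lower)
import Level
open import Relation.Binary.Bundles using (Poset)
open import Relation.Binary.Core using (Rel)
open import Relation.Binary.Definitions using (DecidableEquality; tri<; tri≈; tri>)
open import Relation.Binary.PropositionalEquality.Core as ≡ using (_≡_; _≢_; refl; cong; subst)
open import Relation.Binary.Structures using (IsTotalOrder)
open import Relation.Nullary.Decidable.Core using (yes; no; map′; recompute; decidable-stable)
open import Relation.Nullary.Negation.Core using (¬_; contradiction)
open import Relation.Unary using (_∈_)

-- Coding pairs of natural numbers.

pair : ℕ × ℕ → ℕ
pair (m , n) = (m ℕ.+ n) ℕ.* (m ℕ.+ n) ℕ.+ n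

-- With `s = m + n`, the bound `n ≤ s` keeps the code `s² + n` below `(s + 1)²`, so codes with
-- different sums lie in disjoint intervals.
pair-mono-sum : ∀ m n m′ n′ → m ℕ.+ n ℕ.< m′ ℕ.+ n′ → pair (m , n) ℕ.< pair (m′ , n′)
pair-mono-sum m n m′ n′ s<s′ = begin-strict
  s ℕ.* s ℕ.+ n          ≤⟨ ℕ.+-monoʳ-≤ (s ℕ.* s) (ℕ.m≤n+m n m) ⟩
  s ℕ.* s ℕ.+ s          ≡⟨ ℕ.+-comm (s ℕ.* s) s ⟩
  suc s ℕ.* s            <⟨ ℕ.*-monoʳ-< (suc s) (ℕ.n<1+n s) ⟩
  suc s ℕ.* suc s        ≤⟨ ℕ.*-mono-≤ s<s′ s<s′ ⟩
  s′ ℕ.* s′              ≤⟨ ℕ.m≤m+n (s′ ℕ.* s′) n′ ⟩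
  s′ ℕ.* s′ ℕ.+ n′       ∎
  where
  open ℕ.≤-Reasoning
  s  = m ℕ.+ n
  s′ = m′ ℕ.+ n′

pair-injective : Injective _≡_ _≡_ pair
pair-injective {m , n} {m′ , n′} eq with ℕ.<-cmp (m ℕ.+ n) (m′ ℕ.+ n′)
... | tri< lt _ _ = contradiction eq (ℕ.<⇒≢ (pair-mono-sum m n m′ n′ lt))
... | tri> _ _ gt = contradiction (≡.sym eq) (ℕ.<⇒≢ (pair-mono-sum m′ n′ m n gt))
... | tri≈ _ s≡s′ _ with n≡n′ ←
  ℕ.+-cancelˡ-≡ ((m ℕ.+ n) ℕ.* (m ℕ.+ n)) n n′ (≡.trans eq (cong (λ s → s ℕ.* s ℕ.+ n′) (≡.sym s≡s′)))
  with refl ← n≡n′ = cong (_, n) (ℕ.+-cancelʳ-≡ n m m′ s≡s′)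

value-injective : ∀ {A : Set} {P : A → Set} → Injective _≡_ _≡_ (value {A = A} {P = P})
value-injective {x = a , [ _ ]} {y = .a , [ _ ]} refl = refl

-- Arithmetic of inequalities.

module OrderedField (ℝ : CompleteOrderedField) where
  open CompleteOrderedField ℝ
  open Distributions ℝ using (𝒟; nonNeg; module PointDistribution)
  open import Algebra.Properties.Group +-group using (//-rightDividesˡ; //-rightDividesʳ)
  open import Algebra.Properties.CommutativeMonoid.Mult +-commutativeMonoid public
    using (×-distrib-+) renaming (_×_ to _·_)

  poset : Poset 0ℓ 0ℓ 0ℓ
  poset = record { isPartialOrder = IsTotalOrder.isPartialOrder isTotalOrder }

  open import Relation.Binary.Reasoning.PartialOrder poset public

  0≤1 : 0# ≤ 1#
  -- The point distribution on `⊤` takes the value `1#` at `tt`.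
  0≤1 = nonNeg (PointDistribution.point ⊤._≟_ tt) tt

  1≰0 : ¬ (1# ≤ 0#)
  1≰0 1≤0 = 0≉1 (antisym 0≤1 1≤0)

  +-mono-≤ : ∀ {x y u v} → x ≤ y → u ≤ v → x + u ≤ y + v
  +-mono-≤ {x} {y} {u} {v} x≤y u≤v = begin
    x + u ≤⟨ +-monoˡ-≤ u x≤y ⟩
    y + u ≈⟨ +-comm y u ⟩
    u + y ≤⟨ +-monoˡ-≤ y u≤v ⟩
    v + y ≈⟨ +-comm v y ⟩
    y + v ∎

  x+y≤z⇒x≤z-y : ∀ {x y z} → x + y ≤ z → x ≤ z - y
  x+y≤z⇒x≤z-y {x} {y} {z} x+y≤z = begin
    x           ≈⟨ //-rightDividesʳ y x ⟨
    (x + y) - y ≤⟨ +-monoˡ-≤ (- y) x+y≤z ⟩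
    z - y       ∎

  x≤z-y⇒x+y≤z : ∀ {x y z} → x ≤ z - y → x + y ≤ z
  x≤z-y⇒x+y≤z {x} {y} {z} x≤z-y = begin
    x + y       ≤⟨ +-monoˡ-≤ y x≤z-y ⟩
    (z - y) + y ≈⟨ //-rightDividesˡ y z ⟩
    z           ∎

  +-cancelʳ-≤ : ∀ {x y} z → x + z ≤ y + z → x ≤ y
  +-cancelʳ-≤ {x} {y} z x+z≤y+z = begin
    x           ≤⟨ x+y≤z⇒x≤z-y x+z≤y+z ⟩
    (y + z) - z ≈⟨ //-rightDividesʳ z y ⟩
    y           ∎

  *-monoʳ-≤ : ∀ {x y z} → 0# ≤ z → x ≤ y → z * x ≤ z * y
  *-monoʳ-≤ {x} {y} {z} 0≤z x≤y = begin
    z * x                     ≈⟨ +-identityˡ (z * x) ⟨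
    0# + z * x                ≤⟨ +-monoˡ-≤ (z * x) (*-nonNeg 0≤z 0≤y-x) ⟩
    z * (y - x) + z * x       ≈⟨ distribˡ z (y - x) x ⟨
    z * ((y - x) + x)         ≈⟨ *-congˡ (//-rightDividesˡ x y) ⟩
    z * y                     ∎
    where
    0≤y-x : 0# ≤ y - x
    0≤y-x = x+y≤z⇒x≤z-y (≤-trans (≤-reflexive (+-identityˡ x)) x≤y)

  inverse-nonNeg : ∀ {x y} → 0# ≤ x → x * y ≈ 1# → 0# ≤ y
  inverse-nonNeg {x} {y} 0≤x xy≈1 with total 0# y
  ... | inj₁ 0≤y = 0≤y
  ... | inj₂ y≤0 = ⊥-elim (1≰0 (begin
    1#     ≈⟨ xy≈1 ⟨
    x * y  ≤⟨ *-monoʳ-≤ 0≤x y≤0 ⟩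
    x * 0# ≈⟨ zeroʳ x ⟩
    0#     ∎))

  ·-monoʳ-≤ : ∀ n {x y} → x ≤ y → n · x ≤ n · y
  ·-monoʳ-≤ zero    x≤y = ≤-refl
  ·-monoʳ-≤ (suc n) x≤y = +-mono-≤ x≤y (·-monoʳ-≤ n x≤y)

-- Sums of nonnegative families over arbitrary index sets.

module Summation (em : ExcludedMiddle 1ℓ) (ℝ : CompleteOrderedField) where
  open CompleteOrderedField ℝ
  open Distributions ℝ
  open OrderedField ℝ

  abstract
    em₀ : ExcludedMiddle 0ℓ
    em₀ {P} = map′ lower lift (em {Level.Lift 1ℓ P})

  private variable
    A B I J K : Set
    f g : I → Carrier
    x y z : Carrier

  dec≡ : DecidableEquality A
  dec≡ _ _ = em₀

  -- The value 0 at 0 makes division total and nonnegative on nonnegative arguments; couplings are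
  -- later divided by marginals that may vanish.
  recip : Carrier → Carrier
  recip x with em₀ {x ≈ 0#}
  ... | yes _   = 0#
  ... | no  x≉0 = proj₁ (inverse x x≉0)

  *-recip : ¬ (x ≈ 0#) → x * recip x ≈ 1#
  *-recip {x} x≉0 with em₀ {x ≈ 0#}
  ... | yes x≈0 = contradiction x≈0 x≉0
  ... | no  x≉0 = proj₂ (inverse x x≉0)

  recip-nonNeg : 0# ≤ x → 0# ≤ recip x
  recip-nonNeg {x} 0≤x with em₀ {x ≈ 0#}
  ... | yes _   = ≤-refl
  ... | no  x≉0 = inverse-nonNeg 0≤x (proj₂ (inverse x x≉0))

  cancel-recip : (x ≈ 0# → y ≈ 0#) → x * (recip x * y) ≈ y
  cancel-recip {x} {y} 0⇒0 with em₀ {x ≈ 0#}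
  ... | yes x≈0 = ≈-trans (*-congʳ x≈0) (≈-trans (zeroˡ _) (≈-sym (0⇒0 x≈0)))
  ... | no  x≉0 = begin-equality
    x * (proj₁ (inverse x x≉0) * y) ≈⟨ *-assoc _ _ _ ⟨
    x * proj₁ (inverse x x≉0) * y   ≈⟨ *-congʳ (proj₂ (inverse x x≉0)) ⟩
    1# * y                          ≈⟨ *-identityˡ y ⟩
    y                               ∎

  NonNeg : (I → Carrier) → Set
  NonNeg f = ∀ i → 0# ≤ f i

  ∑-mono : (∀ i → f i ≤ g i) → ∀ is → ∑ f is ≤ ∑ g is
  ∑-mono f≤g []       = ≤-refl
  ∑-mono f≤g (i ∷ is) = +-mono-≤ (f≤g i) (∑-mono f≤g is)

  ∑-cong : (∀ i → f i ≈ g i) → ∀ is → ∑ f is ≈ ∑ g is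
  ∑-cong f≈g []       = ≈-refl
  ∑-cong f≈g (i ∷ is) = +-cong (f≈g i) (∑-cong f≈g is)

  ∑-nonNeg : NonNeg f → ∀ is → 0# ≤ ∑ f is
  ∑-nonNeg f≥0 []       = ≤-refl
  ∑-nonNeg f≥0 (i ∷ is) = ≤-trans (≤-reflexive (≈-sym (+-identityˡ 0#))) (+-mono-≤ (f≥0 i) (∑-nonNeg f≥0 is))

  ∑-zero : ∀ (is : List I) → ∑ (λ _ → 0#) is ≈ 0#
  ∑-zero []       = ≈-refl
  ∑-zero (i ∷ is) = ≈-trans (+-identityˡ _) (∑-zero is)

  open import Algebra.Properties.CommutativeSemigroup +-commutativeSemigroup using (interchange; x∙yz≈y∙xz)

  ∑-+ : ∀ (f g : I → Carrier) is → ∑ (λ i → f i + g i) is ≈ ∑ f is + ∑ g is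
  ∑-+ f g []       = ≈-sym (+-identityˡ 0#)
  ∑-+ f g (i ∷ is) = ≈-trans (+-congˡ (∑-+ f g is)) (interchange (f i) (g i) (∑ f is) (∑ g is))

  ∑-* : ∀ c (f : I → Carrier) is → ∑ (λ i → c * f i) is ≈ c * ∑ f is
  ∑-* c f []       = ≈-sym (zeroʳ c)
  ∑-* c f (i ∷ is) = ≈-trans (+-congˡ (∑-* c f is)) (≈-sym (distribˡ c (f i) (∑ f is)))

  ∑-swap : ∀ (F : I → K → Carrier) is ks → ∑ (λ k → ∑ (λ i → F i k) is) ks ≈ ∑ (λ i → ∑ (F i) ks) is
  ∑-swap F []       ks = ∑-zero ks
  ∑-swap F (i ∷ is) ks = ≈-trans (∑-+ (F i) (λ k → ∑ (λ i → F i k) is) ks) (+-congˡ (∑-swap F is ks))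

  ∑-insert : ∀ (f : I → Carrier) is {i} js → ∑ f (is ++ i ∷ js) ≈ f i + ∑ f (is ++ js)
  ∑-insert f []       js = ≈-refl
  ∑-insert f (j ∷ is) {i} js = ≈-trans (+-congˡ (∑-insert f is js)) (x∙yz≈y∙xz (f j) (f i) _)

  -- Each entry of `is` is matched with one occurrence in `js`, which is then removed; what is left
  -- of `js` at the end only adds nonnegative terms.
  ∑-⊆ : NonNeg f → ∀ {is js} → Unique is → is ⊆ˡ js → ∑ f is ≤ ∑ f js
  ∑-⊆ f≥0 {js = js} [] _ = ∑-nonNeg f≥0 js
  ∑-⊆ {f = f} f≥0 {i ∷ is} {js} (i∉is ∷ uniq) is⊆js
    with as , bs , refl ← ∈-∃++ (is⊆js (here refl)) = begin
    f i + ∑ f is         ≤⟨ +-mono-≤ ≤-refl (∑-⊆ f≥0 uniq is⊆as++bs) ⟩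
    f i + ∑ f (as ++ bs) ≈⟨ ∑-insert f as bs ⟨
    ∑ f (as ++ i ∷ bs)   ∎
    where
    is⊆as++bs : is ⊆ˡ as ++ bs
    is⊆as++bs j∈is with ∈-++⁻ as (is⊆js (there j∈is))
    ... | inj₁ j∈as           = ∈-++⁺ˡ j∈as
    ... | inj₂ (here refl)    = contradiction refl (All.lookup i∉is j∈is)
    ... | inj₂ (there j∈bs)   = ∈-++⁺ʳ as j∈bs

  hasSum : (∀ is → Unique is → ∑ f is ≤ x) →
           (∀ z → (∀ is → Unique is → ∑ f is ≤ z) → x ≤ z) → HasSum f x
  hasSum ub least = (λ { y (is , uniq , y≈) → ≤-trans (≤-reflexive y≈) (ub is uniq) })
                  , (λ z z-ub → least z (λ is uniq → z-ub _ (is , uniq , ≈-refl)))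

  ∑≤sum : HasSum f x → ∀ is → Unique is → ∑ f is ≤ x
  ∑≤sum (ub , _) is uniq = ub _ (is , uniq , ≈-refl)

  sum≤ : HasSum f x → (∀ is → Unique is → ∑ f is ≤ z) → x ≤ z
  sum≤ (_ , least) z-ub = least _ (λ { y (is , uniq , y≈) → ≤-trans (≤-reflexive y≈) (z-ub is uniq) })

  term≤sum : HasSum f x → ∀ i → f i ≤ x
  term≤sum h i = ≤-trans (≤-reflexive (≈-sym (+-identityʳ _))) (∑≤sum h (i ∷ []) ([] ∷ []))

  HasSum-mono : (∀ i → f i ≤ g i) → HasSum f x → HasSum g y → x ≤ y
  HasSum-mono f≤g hf hg = sum≤ hf (λ is uniq → ≤-trans (∑-mono f≤g is) (∑≤sum hg is uniq))

  HasSum-unique : HasSum f x → HasSum f y → x ≈ y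
  HasSum-unique h h′ = antisym (HasSum-mono (λ _ → ≤-refl) h h′) (HasSum-mono (λ _ → ≤-refl) h′ h)

  HasSum-cong : (∀ i → f i ≈ g i) → HasSum f x → HasSum g x
  HasSum-cong f≈g h = hasSum
    (λ is uniq → ≤-trans (≤-reflexive (∑-cong (≈-sym ∘ f≈g) is)) (∑≤sum h is uniq))
    (λ z z-ub → sum≤ h (λ is uniq → ≤-trans (≤-reflexive (∑-cong f≈g is)) (z-ub is uniq)))

  HasSum-resp : x ≈ y → HasSum f x → HasSum f y
  HasSum-resp = isSupremum-resp-≈

  -- The comparison test: completeness is applied to the set of finite sums, which the empty list
  -- inhabits.
  HasSum-bounded : (∀ i → f i ≤ g i) → HasSum g y → ∃ (HasSum f)
  HasSum-bounded f≤g h = complete _ (_ , [] , [] , ≈-refl)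
    (_ , λ { z (is , uniq , z≈) → ≤-trans (≤-reflexive z≈) (≤-trans (∑-mono f≤g is) (∑≤sum h is uniq)) })

  HasSum-nonNeg : HasSum f x → 0# ≤ x
  HasSum-nonNeg h = ∑≤sum h [] []

  HasSum-zero : (∀ i → f i ≈ 0#) → HasSum f 0#
  HasSum-zero f≈0 = HasSum-cong (≈-sym ∘ f≈0)
    (hasSum (λ is _ → ≤-reflexive (∑-zero is)) (λ z z-ub → z-ub [] []))

  -- For leastness, the lists approximating the two sums are merged into one without repetitions; by
  -- nonnegativity it dominates both.
  HasSum-+ : NonNeg f → NonNeg g → HasSum f x → HasSum g y → HasSum (λ i → f i + g i) (x + y)
  HasSum-+ {f = f} {g} {x} {y} f≥0 g≥0 hf hg = hasSum
    (λ is uniq → ≤-trans (≤-reflexive (∑-+ f g is)) (+-mono-≤ (∑≤sum hf is uniq) (∑≤sum hg is uniq)))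
    (λ z z-ub → x≤z-y⇒x+y≤z (sum≤ hf λ is uis →
      x+y≤z⇒x≤z-y (≤-trans (≤-reflexive (+-comm (∑ f is) y))
        (x≤z-y⇒x+y≤z (sum≤ hg λ js ujs →
          x+y≤z⇒x≤z-y (≤-trans (≤-reflexive (+-comm (∑ g js) (∑ f is))) (joint z z-ub is js uis ujs)))))))
    where
    joint : ∀ z → (∀ is → Unique is → ∑ (λ i → f i + g i) is ≤ z) →
            ∀ is js → Unique is → Unique js → ∑ f is + ∑ g js ≤ z
    joint z z-ub is js uis ujs = begin
      ∑ f is + ∑ g js          ≤⟨ +-mono-≤ (∑-⊆ f≥0 uis (∈-deduplicate⁺ dec≡ ∘ ∈-++⁺ˡ))
                                           (∑-⊆ g≥0 ujs (∈-deduplicate⁺ dec≡ ∘ ∈-++⁺ʳ is)) ⟩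
      ∑ f ks + ∑ g ks          ≈⟨ ∑-+ f g ks ⟨
      ∑ (λ i → f i + g i) ks   ≤⟨ z-ub ks (deduplicate-! dec≡ (is ++ js)) ⟩
      z                        ∎
      where ks = deduplicate dec≡ (is ++ js)

  HasSum-∑ : {F : I → K → Carrier} {b : K → Carrier} → (∀ i k → 0# ≤ F i k) →
             (∀ k → HasSum (λ i → F i k) (b k)) → ∀ ks → HasSum (λ i → ∑ (F i) ks) (∑ b ks)
  HasSum-∑ F≥0 h []       = HasSum-zero (λ _ → ≈-refl)
  HasSum-∑ F≥0 h (k ∷ ks) = HasSum-+ (λ i → F≥0 i k) (λ i → ∑-nonNeg (F≥0 i) ks) (h k) (HasSum-∑ F≥0 h ks)

  -- For `c` nonzero, an upper bound of the scaled sums is divided by `c`; the case of zero is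
  -- separate because this division is then impossible.
  HasSum-* : ∀ {c} → 0# ≤ c → HasSum f x → HasSum (λ i → c * f i) (c * x)
  HasSum-* {f = f} {x} {c} 0≤c h with em₀ {c ≈ 0#}
  ... | yes c≈0 = HasSum-resp (≈-sym (c*≈0 x)) (HasSum-zero (c*≈0 ∘ f))
    where
    c*≈0 : ∀ y → c * y ≈ 0#
    c*≈0 y = ≈-trans (*-congʳ c≈0) (zeroˡ y)
  ... | no  c≉0 = hasSum
    (λ is uniq → ≤-trans (≤-reflexive (∑-* c f is)) (*-monoʳ-≤ 0≤c (∑≤sum h is uniq)))
    (λ z z-ub → begin
      c * x              ≤⟨ *-monoʳ-≤ 0≤c (sum≤ h λ is uniq → begin
        ∑ f is                     ≈⟨ r*c* (∑ f is) ⟨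
        recip c * (c * ∑ f is)     ≈⟨ *-congˡ (∑-* c f is) ⟨
        recip c * ∑ (λ i → c * f i) is ≤⟨ *-monoʳ-≤ (recip-nonNeg 0≤c) (z-ub is uniq) ⟩
        recip c * z                ∎) ⟩
      c * (recip c * z)  ≈⟨ *-assoc c (recip c) z ⟨
      c * recip c * z    ≈⟨ *-congʳ (*-recip c≉0) ⟩
      1# * z             ≈⟨ *-identityˡ z ⟩
      z                  ∎)
    where
    r*c* : ∀ y → recip c * (c * y) ≈ y
    r*c* y = begin-equality
      recip c * (c * y) ≈⟨ *-assoc (recip c) c y ⟨
      recip c * c * y   ≈⟨ *-congʳ (≈-trans (*-comm (recip c) c) (*-recip c≉0)) ⟩
      1# * y            ≈⟨ *-identityˡ y ⟩
      y                 ∎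

  HasSum-*ʳ : ∀ {c} → 0# ≤ c → HasSum f x → HasSum (λ i → f i * c) (x * c)
  HasSum-*ʳ {f = f} {x} {c} 0≤c h =
    HasSum-resp (*-comm c x) (HasSum-cong (λ i → *-comm c (f i)) (HasSum-* 0≤c h))

  -- A finite sum of columns is the sum over all rows of partial row sums, hence at most `x`.
  -- Conversely a finite sum of rows is the sum over all columns of partial column sums, hence below
  -- every bound of the finite sums of `b`. The later reindexing and regrouping of sums rests on
  -- this.
  fubini : {F : I → K → Carrier} {a : I → Carrier} {b : K → Carrier} →
           (∀ i k → 0# ≤ F i k) →
           (∀ i → HasSum (F i) (a i)) → (∀ k → HasSum (λ i → F i k) (b k)) →
           HasSum a x → HasSum b x
  fubini {F = F} {a} {b} F≥0 rows cols h = hasSum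
    (λ ks uks → HasSum-mono (λ i → ∑≤sum (rows i) ks uks) (HasSum-∑ F≥0 cols ks) h)
    (λ z z-ub → sum≤ h λ is uis → sum≤ (HasSum-∑ (flip F≥0) rows is) λ ks uks → begin
      ∑ (λ k → ∑ (λ i → F i k) is) ks ≤⟨ ∑-mono (λ k → ∑≤sum (cols k) is uis) ks ⟩
      ∑ b ks                          ≤⟨ z-ub ks uks ⟩
      z                               ∎)

  δ : A → A → Carrier
  δ = PointDistribution.indicator dec≡

  δ-nonNeg : ∀ (a b : A) → 0# ≤ δ a b
  δ-nonNeg a = nonNeg (PointDistribution.point dec≡ a)

  module _ {A : Set} (_≟_ : DecidableEquality A) where
    open PointDistribution _≟_ using (indicator)

    indicator-same : ∀ a → indicator a a ≈ 1#
    indicator-same a with a ≟ a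
    ... | yes _   = ≈-refl
    ... | no  a≢a = contradiction refl a≢a

    indicator-distinct : ∀ {a b} → a ≢ b → indicator a b ≈ 0#
    indicator-distinct {a} {b} a≢b with a ≟ b
    ... | yes a≡b = contradiction a≡b a≢b
    ... | no  _   = ≈-refl

  HasSum-single : ∀ a → 0# ≤ f a → (∀ b → a ≢ b → f b ≈ 0#) → HasSum f (f a)
  HasSum-single {f = f} a 0≤fa off = HasSum-resp (*-identityʳ (f a))
    (HasSum-cong at (HasSum-* 0≤fa (sum≈1 (PointDistribution.point dec≡ a))))
    where
    at : ∀ b → f a * δ a b ≈ f b
    at b with em₀ {a ≡ b}
    ... | yes refl = *-identityʳ (f a)
    ... | no  a≢b  = ≈-trans (zeroʳ (f a)) (≈-sym (off b a≢b))

  HasSum-δ : NonNeg f → ∀ a → HasSum (λ b → f b * δ a b) (f a)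
  HasSum-δ {f = f} f≥0 a = HasSum-resp (≈-trans (*-congˡ (indicator-same dec≡ a)) (*-identityʳ (f a)))
    (HasSum-single a (*-nonNeg (f≥0 a) (δ-nonNeg a a))
      (λ b a≢b → ≈-trans (*-congˡ (indicator-distinct dec≡ a≢b)) (zeroʳ (f b))))

  module _ {A B : Set} {g : A → B} {f : B → Carrier} (inj : Injective _≡_ _≡_ g) (f≥0 : NonNeg f) where

    private
      -- This matrix spreads `f` along the graph of `g`. Row `a` sums to `f (g a)`; column `b` sums
      -- to `f b` because `g` is injective and `f` vanishes off its image. Exchanging rows and
      -- columns gives both directions of reindexing.
      F : A → B → Carrier
      F a b = f b * δ (g a) b

      F≥0 : ∀ a b → 0# ≤ F a b
      F≥0 a b = *-nonNeg (f≥0 b) (δ-nonNeg (g a) b)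

      F-distinct : ∀ {a b} → g a ≢ b → F a b ≈ 0#
      F-distinct {b = b} ga≢b = ≈-trans (*-congˡ (indicator-distinct dec≡ ga≢b)) (zeroʳ (f b))

      rows : ∀ a → HasSum (F a) (f (g a))
      rows a = HasSum-δ f≥0 (g a)

      cols : (∀ b → (∀ a → g a ≢ b) → f b ≈ 0#) → ∀ b → HasSum (λ a → F a b) (f b)
      cols off b with em₀ {∃ λ a → g a ≡ b}
      ... | yes (a , refl) = HasSum-resp (≈-trans (*-congˡ (indicator-same dec≡ (g a))) (*-identityʳ _))
        (HasSum-single a (F≥0 a (g a)) (λ a′ a≢a′ → F-distinct (a≢a′ ∘ inj ∘ ≡.sym)))
      ... | no ∄a = HasSum-resp (≈-sym (off b (λ a ga≡b → ∄a (a , ga≡b))))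
        (HasSum-zero (λ a → F-distinct (λ ga≡b → ∄a (a , ga≡b))))

    HasSum-extend : (∀ b → (∀ a → g a ≢ b) → f b ≈ 0#) → HasSum (f ∘ g) x → HasSum f x
    HasSum-extend off = fubini F≥0 rows (cols off)

    HasSum-restrict : (∀ b → (∀ a → g a ≢ b) → f b ≈ 0#) → HasSum f x → HasSum (f ∘ g) x
    HasSum-restrict off = fubini (flip F≥0) (cols off) rows

  -- The rows are indexed by `A` and the columns by `A × B`, with row `i` keeping only the pairs
  -- that begin with `i`. Each column then has a single possibly nonzero entry.
  HasSum-uncurry : {F : A × B → Carrier} {a : A → Carrier} → NonNeg F →
                   (∀ i → HasSum (λ k → F (i , k)) (a i)) → HasSum a x → HasSum F x
  HasSum-uncurry {A = A} {B = B} {F = F} {a} F≥0 rows =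
    fubini {F = λ i ik → F ik * δ i (proj₁ ik)} (λ i ik → *-nonNeg (F≥0 ik) (δ-nonNeg i _)) row col
    where
    row : ∀ i → HasSum (λ ik → F ik * δ i (proj₁ ik)) (a i)
    row i = HasSum-extend {g = i ,_} (λ { refl → refl }) (λ ik → *-nonNeg (F≥0 ik) (δ-nonNeg i _))
      (λ { (j , k) off → ≈-trans (*-congˡ (indicator-distinct dec≡ λ { refl → off k refl })) (zeroʳ _) })
      (HasSum-cong (λ k → ≈-sym (≈-trans (*-congˡ (indicator-same dec≡ i)) (*-identityʳ _))) (rows i))

    col : ∀ ik → HasSum (λ i → F ik * δ i (proj₁ ik)) (F ik)
    col (i , k) = HasSum-resp (≈-trans (*-congˡ (indicator-same dec≡ i)) (*-identityʳ _))
      (HasSum-single i (*-nonNeg (F≥0 (i , k)) (δ-nonNeg i i))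
        (λ j i≢j → ≈-trans (*-congˡ (indicator-distinct dec≡ (i≢j ∘ ≡.sym))) (zeroʳ _)))

  -- Positive weights and the countability of supports.

  nonPos⇒≈0 : 0# ≤ x → ¬ (0# < x) → x ≈ 0#
  nonPos⇒≈0 {x} 0≤x ≮ = decidable-stable em₀ (λ x≉0 → ≮ (0≤x , x≉0 ∘ ≈-sym))

  off-support : {p : I → Carrier} → NonNeg p →
                ∀ i → ((k : [ i ∈ I ∣ 0# < p i ]) → value k ≢ i) → p i ≈ 0#
  off-support p≥0 i off = nonPos⇒≈0 (p≥0 i) (λ 0<pi → off (i , [ 0<pi ]) refl)

  -- Otherwise the multiples of `x` have a supremum `σ`. It also bounds every next multiple, so
  -- `σ - x` is an upper bound too, and `σ ≤ σ - x` forces `x ≤ 0#`.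
  archimedean : 0# < x → ∃[ n ] 1# ≤ n · x
  archimedean {x} (0≤x , 0≉x) with em₀ {∃[ n ] 1# ≤ n · x}
  ... | yes found = found
  ... | no  ∄n = contradiction (antisym 0≤x x≤0) 0≉x
    where
    bounded : ∀ n → n · x ≤ 1#
    bounded n with total (n · x) 1#
    ... | inj₁ ≤1 = ≤1
    ... | inj₂ 1≤ = contradiction (n , 1≤) ∄n
    sup : ∃ (IsSupremum (λ y → ∃[ n ] y ≈ n · x))
    sup = complete _ (0# , 0 , ≈-refl) (1# , λ { y (n , y≈) → ≤-trans (≤-reflexive y≈) (bounded n) })
    σ = proj₁ sup
    σ≤σ-x : σ ≤ σ - x
    σ≤σ-x = proj₂ (proj₂ sup) (σ - x) λ { y (n , y≈) → x+y≤z⇒x≤z-y (begin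
      y + x      ≈⟨ +-comm y x ⟩
      x + y      ≈⟨ +-congˡ y≈ ⟩
      suc n · x  ≤⟨ proj₁ (proj₂ sup) _ (suc n , ≈-refl) ⟩
      σ          ∎) }
    x≤0 : x ≤ 0#
    x≤0 = +-cancelʳ-≤ σ (begin
      x + σ   ≈⟨ +-comm x σ ⟩
      σ + x   ≤⟨ x≤z-y⇒x+y≤z σ≤σ-x ⟩
      σ       ≈⟨ +-identityˡ σ ⟨
      0# + σ  ∎)

  module _ {I : Set} {p : I → Carrier} (p≥0 : NonNeg p) (p-sum : HasSum p 1#) where

    -- If no list were exhaustive, fresh heavy indices could be picked repeatedly; `n + 1` distinct
    -- ones would give `n + 1 ≤ n · ∑ p ≤ n`.
    heavy-finite : ∀ n → Σ[ is ∈ List I ] (∀ i → 1# ≤ n · p i → i ∈ˡ is)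
    heavy-finite n with em₀ {Σ[ is ∈ List I ] (∀ i → 1# ≤ n · p i → i ∈ˡ is)}
    ... | yes found = found
    ... | no  ∄is = contradiction 1≤0 1≰0
      where
      fresh : ∀ is → Σ[ i ∈ I ] 1# ≤ n · p i × i ∉ˡ is
      fresh is = decidable-stable em₀ λ ∄i → ∄is
        (is , λ i heavy → decidable-stable em₀ (λ i∉is → ∄i (i , heavy , i∉is)))
      many : ∀ m → Σ[ is ∈ List I ] Unique is × m · 1# ≤ n · ∑ p is
      many zero    = [] , [] , nonNeg-· n
        where
        nonNeg-· : ∀ n → 0# ≤ n · 0#
        nonNeg-· zero    = ≤-refl
        nonNeg-· (suc n) = ≤-trans (nonNeg-· n) (≤-reflexive (≈-sym (+-identityˡ _)))
      many (suc m) with is , uniq , m≤ ← many m with i , heavy , i∉is ← fresh is =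
        i ∷ is , ¬Any⇒All¬ is i∉is ∷ uniq , (begin
          1# + m · 1#               ≤⟨ +-mono-≤ heavy m≤ ⟩
          n · p i + n · ∑ p is      ≈⟨ ×-distrib-+ (p i) (∑ p is) n ⟨
          n · (p i + ∑ p is)        ∎)
      1≤0 : 1# ≤ 0#
      1≤0 with is , uniq , n< ← many (suc n) = +-cancelʳ-≤ (n · 1#) (begin
        1# + n · 1#  ≤⟨ n< ⟩
        n · ∑ p is   ≤⟨ ·-monoʳ-≤ n (∑≤sum p-sum is uniq) ⟩
        n · 1#       ≈⟨ +-identityˡ _ ⟨
        0# + n · 1#  ∎)

    -- An index is coded by a level `n` at which it is heavy, together with its position in the
    -- finite list for that level.
    support-countable : Countable [ i ∈ I ∣ 0# < p i ]
    support-countable = mk↣ {to = code} code-injective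
      where
      level : (k : [ i ∈ I ∣ 0# < p i ]) → ∃[ n ] 1# ≤ n · p (value k)
      -- The positivity proof is irrelevant; decidability lets `recompute` restore a usable one.
      level (i , [ 0<pi ]) = archimedean (recompute em₀ 0<pi)
      position : (k : [ i ∈ I ∣ 0# < p i ]) → value k ∈ˡ proj₁ (heavy-finite (proj₁ (level k)))
      position k = proj₂ (heavy-finite (proj₁ (level k))) (value k) (proj₂ (level k))
      code : [ i ∈ I ∣ 0# < p i ] → ℕ
      code k = pair (proj₁ (level k) , toℕ (index (position k)))
      same-position : ∀ {n n′ i i′} (q : i ∈ˡ proj₁ (heavy-finite n)) (q′ : i′ ∈ˡ proj₁ (heavy-finite n′)) →
                      (n , toℕ (index q)) ≡ (n′ , toℕ (index q′)) → i ≡ i′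
      same-position {n} q q′ eq with refl ← cong proj₁ eq =
        ≡.trans (lookup-index q) (≡.trans
          (cong (lookup (proj₁ (heavy-finite n))) (Fin.toℕ-injective (cong proj₂ eq)))
          (≡.sym (lookup-index q′)))
      code-injective : Injective _≡_ _≡_ code
      code-injective {k} {k′} eq =
        value-injective (same-position (position k) (position k′) (pair-injective eq))

-- Convex combinations of distributions.

module Mixtures (em : ExcludedMiddle 1ℓ) (ℝ : CompleteOrderedField)
                {S : Set} (_≟_ : DecidableEquality S) where
  open CompleteOrderedField ℝ
  open Distributions ℝ
  open OrderedField ℝ
  open Summation em ℝ
  open PointDistribution _≟_
  open IsConvexCombination

  private variable
    I J K : Set
    p : I → Carrier
    Δ Θ : 𝒟 S
    Δs Θs : I → 𝒟 S

  -- Each column is dominated by the row sums `a`, so it has a sum; exchanging summations gives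
  -- total mass 1.
  column-distribution : {V : I → S → Carrier} {a : I → Carrier} → (∀ i s → 0# ≤ V i s) →
                        (∀ i → HasSum (V i) (a i)) → HasSum a 1# →
                        Σ[ Θ ∈ 𝒟 S ] (∀ s → HasSum (λ i → V i s) (prob Θ s))
  column-distribution {V = V} V≥0 rows a-sum = Ξ , λ s → proj₂ (column s)
    where
    column : ∀ s → ∃ (HasSum (λ i → V i s))
    column s = HasSum-bounded (λ i → term≤sum (rows i) s) a-sum
    Ξ : 𝒟 S
    Ξ = record
      { prob   = proj₁ ∘ column
      ; nonNeg = λ s → HasSum-nonNeg (proj₂ (column s))
      ; sum≈1  = fubini V≥0 rows (proj₂ ∘ column) a-sum
      }

  mixture : NonNeg p → HasSum p 1# → (Δs : I → 𝒟 S) → Σ[ Δ ∈ 𝒟 S ] IsConvexCombination p Δs Δ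
  mixture {p = p} p≥0 p-sum Δs with column-distribution (λ i s → *-nonNeg (p≥0 i) (nonNeg (Δs i) s))
      (λ i → HasSum-resp (*-identityʳ (p i)) (HasSum-* (p≥0 i) (sum≈1 (Δs i)))) p-sum
  ... | Δ , cols = Δ , record { p-nonNeg = p≥0 ; p-sum≈1 = p-sum ; pointwise = cols }

  constant-combination : NonNeg p → HasSum p 1# → (Δ : 𝒟 S) → IsConvexCombination p (λ _ → Δ) Δ
  constant-combination p≥0 p-sum Δ = record
    { p-nonNeg  = p≥0
    ; p-sum≈1   = p-sum
    ; pointwise = λ s → HasSum-resp (*-identityˡ _) (HasSum-*ʳ (nonNeg Δ s) p-sum)
    }

  δ-combination : (Δs : K → 𝒟 S) (k : K) → IsConvexCombination (δ k) Δs (Δs k)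
  δ-combination Δs k = record
    { p-nonNeg  = δ-nonNeg k
    ; p-sum≈1   = sum≈1 (PointDistribution.point dec≡ k)
    ; pointwise = λ s → HasSum-cong (λ _ → *-comm _ _) (HasSum-δ (λ j → nonNeg (Δs j) s) k)
    }

  -- The new weight of `Γs k` is the `k`-th column sum of the matrix `p i * q i k`.
  flatten : {q : I → K → Carrier} {Γs : K → 𝒟 S} → IsConvexCombination p Δs Δ →
            (∀ i → IsConvexCombination (q i) Γs (Δs i)) → ∃ λ r → IsConvexCombination r Γs Δ
  flatten {I = I} {K = K} {p = p} {Δs = Δs} {Δ = Δ} {q} {Γs} c d = proj₁ ∘ weight , record
    { p-nonNeg  = λ k → HasSum-nonNeg (proj₂ (weight k))
    ; p-sum≈1   = fubini pq≥0 pq-rows (proj₂ ∘ weight) (p-sum≈1 c)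
    ; pointwise = λ s → fubini
        {F = λ i k → p i * q i k * prob (Γs k) s}
        (λ i k → *-nonNeg (pq≥0 i k) (nonNeg (Γs k) s))
        (λ i → HasSum-cong (λ k → ≈-sym (*-assoc _ _ _)) (HasSum-* (p-nonNeg c i) (pointwise (d i) s)))
        (λ k → HasSum-*ʳ (nonNeg (Γs k) s) (proj₂ (weight k)))
        (pointwise c s)
    }
    where
    pq≥0 : ∀ i k → 0# ≤ p i * q i k
    pq≥0 i k = *-nonNeg (p-nonNeg c i) (p-nonNeg (d i) k)
    pq-rows : ∀ i → HasSum (λ k → p i * q i k) (p i)
    pq-rows i = HasSum-resp (*-identityʳ _) (HasSum-* (p-nonNeg c i) (p-sum≈1 (d i)))
    weight : ∀ k → ∃ (HasSum (λ i → p i * q i k))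
    weight k = HasSum-bounded (λ i → term≤sum (pq-rows i) k) (p-sum≈1 c)

  -- Dropping zero weights leaves a countable index set, as liftings demand. It also turns the
  -- combination of points with weights `prob Δ` into one indexed by `⌈ Δ ⌉`, the form that `X[ Δ ]`
  -- uses.
  support-combination : IsConvexCombination p Δs Δ →
    IsConvexCombination {I = [ i ∈ I ∣ 0# < p i ]} (p ∘ value) (Δs ∘ value) Δ
  support-combination {p = p} {Δs = Δs} c = record
    { p-nonNeg  = p-nonNeg c ∘ value
    ; p-sum≈1   = HasSum-restrict value-injective (p-nonNeg c) (off-support (p-nonNeg c)) (p-sum≈1 c)
    ; pointwise = λ s → HasSum-restrict value-injective
        (λ i → *-nonNeg (p-nonNeg c i) (nonNeg (Δs i) s))
        (λ i off → ≈-trans (*-congʳ (off-support (p-nonNeg c) i off)) (zeroˡ _))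
        (pointwise c s)
    }

  HasSum-indicator : {f : S → Carrier} → NonNeg f → ∀ s → HasSum (λ x → f x * indicator x s) (f s)
  HasSum-indicator {f} f≥0 s =
    HasSum-resp (≈-trans (*-congˡ (indicator-same _≟_ s)) (*-identityʳ (f s)))
      (HasSum-single s (*-nonNeg (f≥0 s) (nonNeg (point s) s))
        (λ x s≢x → ≈-trans (*-congˡ (indicator-distinct _≟_ (s≢x ∘ ≡.sym))) (zeroʳ (f x))))

  point-combination : (Δ : 𝒟 S) → IsConvexCombination (prob Δ) point Δ
  point-combination Δ = record
    { p-nonNeg = nonNeg Δ ; p-sum≈1 = sum≈1 Δ ; pointwise = HasSum-indicator (nonNeg Δ) }

  support-point : ∀ {x y} → y ∈ Support (point x) → x ≡ y
  support-point {x} {y} (_ , 0≉) with x ≟ y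
  ... | yes x≡y = x≡y
  ... | no  _   = contradiction ≈-refl 0≉

  -- If Δ = ∑ᵢ pᵢ · Δᵢ, a term of weight pᵢ = 0 carries no information about Δᵢ.
  weight≈0 : IsConvexCombination p Δs Δ → ∀ i s → prob Δ s ≈ 0# → 0# < p i → prob (Δs i) s ≈ 0#
  weight≈0 {p = p} {Δs = Δs} {Δ = Δ} c i s Δs≈0 (0≤p , 0≉p) = begin-equality
    prob (Δs i) s                        ≈⟨ *-identityˡ _ ⟨
    1# * prob (Δs i) s                   ≈⟨ *-congʳ (*-recip (0≉p ∘ ≈-sym)) ⟨
    p i * recip (p i) * prob (Δs i) s    ≈⟨ *-congʳ (*-comm _ _) ⟩
    recip (p i) * p i * prob (Δs i) s    ≈⟨ *-assoc _ _ _ ⟩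
    recip (p i) * (p i * prob (Δs i) s)  ≈⟨ *-congˡ p*≈0 ⟩
    recip (p i) * 0#                     ≈⟨ zeroʳ _ ⟩
    0#                                   ∎
    where
    p*≈0 : p i * prob (Δs i) s ≈ 0#
    p*≈0 = antisym (≤-trans (term≤sum (pointwise c s) i) (≤-reflexive Δs≈0))
                   (*-nonNeg 0≤p (nonNeg (Δs i) s))

  -- Couplings.

  record Coupling (R : Rel S 1ℓ) (Δ Θ : 𝒟 S) : Set 1ℓ where
    field
      W    : S → S → Carrier
      W≥0  : ∀ x y → 0# ≤ W x y
      rows : ∀ x → HasSum (W x) (prob Δ x)
      cols : ∀ y → HasSum (λ x → W x y) (prob Θ y)
      off  : ∀ {x y} → ¬ R x y → W x y ≈ 0#
  open Coupling

  private variable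
    R Q : Rel S 1ℓ

  Coupling-map : (∀ {x y} → R x y → Q x y) → Coupling R Δ Θ → Coupling Q Δ Θ
  Coupling-map R⇒Q w = record
    { W = W w ; W≥0 = W≥0 w ; rows = rows w ; cols = cols w ; off = λ ¬q → off w (¬q ∘ R⇒Q) }

  Coupling-flip : Coupling R Δ Θ → Coupling (flip R) Θ Δ
  Coupling-flip w = record
    { W = flip (W w) ; W≥0 = flip (W≥0 w) ; rows = cols w ; cols = rows w ; off = off w }

  -- The product of the marginals works: its mass lies in row `x`, on the support of `Θ`.
  Coupling-point⁺ : ∀ {x} → (∀ y → y ∈ Support Θ → R x y) → Coupling R (point x) Θ
  Coupling-point⁺ {Θ = Θ} {R = R} {x} h = record
    { W    = λ z y → indicator x z * prob Θ y
    ; W≥0  = λ z y → *-nonNeg (nonNeg (point x) z) (nonNeg Θ y)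
    ; rows = λ z → HasSum-resp (*-identityʳ _) (HasSum-* (nonNeg (point x) z) (sum≈1 Θ))
    ; cols = λ y → HasSum-resp (*-identityˡ _) (HasSum-*ʳ (nonNeg Θ y) (sum≈1 (point x)))
    ; off  = off′
    }
    where
    off′ : ∀ {z y} → ¬ R z y → indicator x z * prob Θ y ≈ 0#
    off′ {z} {y} ¬r with x ≟ z
    ... | yes refl = ≈-trans (*-identityˡ _) (nonPos⇒≈0 (nonNeg Θ y) (¬r ∘ h y))
    ... | no  _    = zeroˡ _

  -- If `R x y` failed, column `y` would vanish: its entry in row `x` lies off `R`, and every other
  -- row has total mass zero.
  Coupling-point⁻ : ∀ {x} → Coupling R (point x) Θ → ∀ y → y ∈ Support Θ → R x y
  Coupling-point⁻ {R = R} {Θ = Θ} {x} w y (_ , 0≉Θy) = decidable-stable em λ ¬r →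
    0≉Θy (≈-sym (HasSum-unique (cols w y) (HasSum-zero (zero-column ¬r))))
    where
    zero-column : ¬ R x y → ∀ z → W w z y ≈ 0#
    zero-column ¬r z with x ≟ z | term≤sum (rows w z) y
    ... | yes refl | _   = off w ¬r
    ... | no  _    | W≤0 = antisym W≤0 (W≥0 w z y)

  -- The matrices are averaged with the weights `p`.
  Coupling-mixture : IsConvexCombination p Δs Δ → IsConvexCombination p Θs Θ →
                     (∀ i → Coupling R (Δs i) (Θs i)) → Coupling R Δ Θ
  Coupling-mixture {p = p} {Δs = Δs} {R = R} c d ws = record
    { W    = λ x y → proj₁ (weight x y)
    ; W≥0  = λ x y → HasSum-nonNeg (proj₂ (weight x y))
    ; rows = λ x → fubini {F = λ i y → p i * W (ws i) x y} (λ i y → pW≥0 i x y)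
               (λ i → HasSum-* (p-nonNeg c i) (rows (ws i) x)) (λ y → proj₂ (weight x y)) (pointwise c x)
    ; cols = λ y → fubini {F = λ i x → p i * W (ws i) x y} (λ i x → pW≥0 i x y)
               (λ i → HasSum-* (p-nonNeg c i) (cols (ws i) y)) (λ x → proj₂ (weight x y)) (pointwise d y)
    ; off  = λ {x} {y} ¬r → HasSum-unique (proj₂ (weight x y))
               (HasSum-zero (λ i → ≈-trans (*-congˡ (off (ws i) ¬r)) (zeroʳ (p i))))
    }
    where
    pW≥0 : ∀ i x y → 0# ≤ p i * W (ws i) x y
    pW≥0 i x y = *-nonNeg (p-nonNeg c i) (W≥0 (ws i) x y)
    weight : ∀ x y → ∃ (HasSum (λ i → p i * W (ws i) x y))
    weight x y = HasSum-bounded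
      (λ i → *-monoʳ-≤ (p-nonNeg c i) (term≤sum (rows (ws i) x) y)) (pointwise c x)

  -- Dividing the coupling W by Δ gives a kernel x ↦ W x · / Δ x that transports Δ to Θ; it
  -- transports each Δⱼ to Θⱼ.  When qⱼ = 0 the kernel may be undefined on the support of Δⱼ.
  Coupling-decompose : {q : J → Carrier} → IsConvexCombination q Δs Δ → Coupling R Δ Θ →
    (∀ j → ¬ (0# < q j) → ∃ (Coupling R (Δs j))) →
    ∃ λ Θs → IsConvexCombination q Θs Θ × (∀ j → Coupling R (Δs j) (Θs j))
  Coupling-decompose {J = J} {Δs = Δs} {Δ = Δ} {R = R} {Θ = Θ} {q = q} c w default =
    proj₁ ∘ piece
    , record
      { p-nonNeg  = p-nonNeg c
      ; p-sum≈1   = p-sum≈1 c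
      ; pointwise = λ y → fubini {F = λ x j → q j * (prob (Δs j) x * κ x y)}
          (λ x j → *-nonNeg (p-nonNeg c j) (V≥0 j x y))
          (λ x → HasSum-cong (λ j → *-assoc _ _ _)
                   (HasSum-resp (Δκ≈W x y) (HasSum-*ʳ (κ≥0 x y) (pointwise c x))))
          (λ j → proj₂ (proj₂ (piece j)) y)
          (cols w y)
      }
    , λ j → proj₁ (proj₂ (piece j))
    where
    κ : S → S → Carrier
    κ x y = recip (prob Δ x) * W w x y

    κ≥0 : ∀ x y → 0# ≤ κ x y
    κ≥0 x y = *-nonNeg (recip-nonNeg (nonNeg Δ x)) (W≥0 w x y)

    V≥0 : ∀ j x y → 0# ≤ prob (Δs j) x * κ x y
    V≥0 j x y = *-nonNeg (nonNeg (Δs j) x) (κ≥0 x y)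

    Δκ≈W : ∀ x y → prob Δ x * κ x y ≈ W w x y
    Δκ≈W x y = cancel-recip (λ Δx≈0 →
      antisym (≤-trans (term≤sum (rows w x) y) (≤-reflexive Δx≈0)) (W≥0 w x y))

    -- Where `Δ` vanishes, the kernel row is zero instead of a probability row. This is harmless: as
    -- `q j` is positive, `Δs j` vanishes there as well.
    V-rows : ∀ j → 0# < q j → ∀ x → HasSum (λ y → prob (Δs j) x * κ x y) (prob (Δs j) x)
    V-rows j 0<q x = HasSum-resp
      (≈-trans (*-congˡ (*-comm _ _)) cancel-recip′)
      (HasSum-* (nonNeg (Δs j) x) (HasSum-* (recip-nonNeg (nonNeg Δ x)) (rows w x)))
      where
      cancel-recip′ : prob (Δs j) x * (prob Δ x * recip (prob Δ x)) ≈ prob (Δs j) x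
      cancel-recip′ = ≈-trans (*-comm _ _) (≈-trans (*-assoc _ _ _)
        (cancel-recip (λ Δx≈0 → weight≈0 c j x Δx≈0 0<q)))

    Piece : J → Set 1ℓ
    Piece j = Σ[ Θ′ ∈ 𝒟 S ] Coupling R (Δs j) Θ′ ×
                (∀ y → HasSum (λ x → q j * (prob (Δs j) x * κ x y)) (q j * prob Θ′ y))

    piece : ∀ j → Piece j
    piece j with em₀ {0# < q j}
    ... | yes 0<q with column-distribution (V≥0 j) (V-rows j 0<q) (sum≈1 (Δs j))
    ...   | Θ′ , V-cols = Θ′
            , record { W = λ x y → prob (Δs j) x * κ x y ; W≥0 = V≥0 j ; rows = V-rows j 0<q ; cols = V-cols
                     ; off = λ ¬r → ≈-trans (*-congˡ (≈-trans (*-congˡ (off w ¬r)) (zeroʳ _))) (zeroʳ _) }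
            , λ y → HasSum-* (p-nonNeg c j) (V-cols y)
    -- A term of weight zero contributes nothing to `Θ`, so any partner of `Δs j` will do.
    piece j | no ≮ with default j ≮
    ...   | Θ′ , v = Θ′ , v , λ y → HasSum-resp (≈-sym (q*≈0 _)) (HasSum-zero (λ x → q*≈0 _))
      where
      q*≈0 : ∀ a → q j * a ≈ 0#
      q*≈0 a = ≈-trans (*-congʳ (nonPos⇒≈0 (p-nonNeg c j) ≮)) (zeroˡ a)

-- Liftings as couplings.

module Characteristic (em : ExcludedMiddle 1ℓ) {ℝ : CompleteOrderedField} (L : PLTS ℝ)
                      (V : Variables (PLTS.S L)) where
  open CompleteOrderedField ℝ
  open Distributions ℝ
  open PLTS L
  open Variables V
  open Bisimulation L
  open Logic L V
  open Summation em ℝ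
  open Mixtures em ℝ _≟_
  open Coupling
  open IsConvexCombination
  open PointDistribution _≟_ using (indicator)

  private variable
    R : Rel S 1ℓ
    Δ Θ : 𝒟 S
    s t : S
    a : Actτ

  Lift⇒Coupling : Lift R Δ Θ → Coupling R Δ Θ
  Lift⇒Coupling {R = R} l = Coupling-mixture left right λ i → Coupling-point⁺ λ y y∈ →
    subst (R (Lift.s l i)) (support-point y∈) (related i)
    where open Lift l using (left; right; related)

  S×S-countable : Countable (S × S)
  S×S-countable = mk↣ Fin.toℕ-injective ↣-∘ ↔⇒↣ (↔-sym Fin.*↔× ↔-∘ (proj₂ finite ×-↔ proj₂ finite))

  -- The index set consists of the pairs of positive weight. Such a pair is related, since `W`
  -- vanishes off `R`; excluded middle at the type `R x y` extracts the witness.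
  Coupling⇒Lift : Coupling R Δ Θ → Lift R Δ Θ
  Coupling⇒Lift {R = R} {Δ = Δ} {Θ = Θ} w = record
    { countable = S×S-countable ↣-∘ mk↣ value-injective
    ; related   = λ { ((x , y) , [ 0<W ]) →
        decidable-stable em (λ ¬r → proj₂ (recompute em₀ 0<W) (≈-sym (off w ¬r))) }
    ; left      = support-combination pairs-left
    ; right     = support-combination pairs-right
    }
    where
    W≥0′ : NonNeg (uncurry (W w))
    W≥0′ (x , y) = W≥0 w x y
    total-weight : HasSum (uncurry (W w)) 1#
    total-weight = HasSum-uncurry W≥0′ (rows w) (sum≈1 Δ)
    pairs-left : IsConvexCombination (uncurry (W w)) (point ∘ proj₁) Δ
    pairs-left = record
      { p-nonNeg  = W≥0′
      ; p-sum≈1   = total-weight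
      ; pointwise = λ z → HasSum-uncurry
          (λ { (x , y) → *-nonNeg (W≥0 w x y) (nonNeg (point x) z) })
          (λ x → HasSum-*ʳ (nonNeg (point x) z) (rows w x)) (HasSum-indicator (nonNeg Δ) z)
      }
    pairs-right : IsConvexCombination (uncurry (W w)) (point ∘ proj₂) Θ
    pairs-right = record
      { p-nonNeg  = W≥0′
      ; p-sum≈1   = total-weight
      ; pointwise = λ z → HasSum-uncurry
          (λ { (x , y) → *-nonNeg (W≥0 w x y) (nonNeg (point y) z) })
          (λ x → HasSum-indicator (W≥0 w x) z) (cols w z)
      }

  -- Combined transitions from a point distribution.

  Transition : S → Actτ → Set
  Transition s a = ∃[ Δ ] (s -[ a ]→ Δ)

  step⇒ : s -[ a ]→ Δ → point s =[ a ]⇒ Δ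
  step⇒ {s} {Δ = Δ} tr = record
    { I         = ⊤
    ; countable = mk↣ {to = λ _ → 0} (λ _ → refl)
    ; related   = λ _ → tr
    ; left      = δ-combination (λ _ → point s) tt
    ; right     = δ-combination (λ _ → Δ) tt
    }

  -- In a combined transition from a point distribution, the components that do not
  -- start in s have weight zero; they are redirected to some transition of s.
  ⇒-combination : point s =[ a ]⇒ Δ → ∃ λ r → IsConvexCombination {I = Transition s a} r proj₁ Δ
  ⇒-combination {s} {a} {Δ} l = flatten redirected (λ i → δ-combination proj₁ (transition i))
    where
    open Liftᴰ l renaming (s to source)
    open OrderedField ℝ

    -- Component `i` puts mass `p i` on its source, where `point s` has no mass if the source
    -- differs from `s`.
    stray : ∀ {i} → source i ≢ s → p i ≈ 0#
    stray {i} s≢ = antisym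
      (begin
        p i                                   ≈⟨ *-identityʳ (p i) ⟨
        p i * 1#                              ≈⟨ *-congˡ (indicator-same _≟_ (source i)) ⟨
        p i * indicator (source i) (source i) ≤⟨ term≤sum (pointwise left (source i)) i ⟩
        indicator s (source i)                ≈⟨ indicator-distinct _≟_ (s≢ ∘ ≡.sym) ⟩
        0#                                    ∎)
      (p-nonNeg left i)

    -- If every component were stray, all weights would vanish and could not sum to 1.
    entry : ∃[ i ] source i ≡ s
    entry = decidable-stable em₀ λ ∄i → 0≉1
      (HasSum-unique (HasSum-zero (λ i → stray (λ eq → ∄i (i , eq)))) (p-sum≈1 left))

    transition : I → Transition s a
    transition i with source i ≟ s
    ... | yes eq = Θs i , subst (_-[ a ]→ Θs i) eq (related i)
    ... | no  _  = Θs (proj₁ entry) , subst (_-[ a ]→ Θs (proj₁ entry)) (proj₂ entry) (related (proj₁ entry))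

    redirect : ∀ z i → p i * prob (Θs i) z ≈ p i * prob (proj₁ (transition i)) z
    redirect z i with source i ≟ s
    ... | yes _  = ≈-refl
    ... | no  s≢ = ≈-trans (≈-trans (*-congʳ (stray s≢)) (zeroˡ _))
                           (≈-sym (≈-trans (*-congʳ (stray s≢)) (zeroˡ _)))

    redirected : IsConvexCombination p (proj₁ ∘ transition) Δ
    redirected = record
      { p-nonNeg  = p-nonNeg left
      ; p-sum≈1   = p-sum≈1 left
      ; pointwise = λ z → HasSum-cong (redirect z) (pointwise right z)
      }

  -- Only the countably many transitions of positive weight are kept.
  combination-⇒ : ∀ {r} → IsConvexCombination {I = Transition s a} r proj₁ Δ → point s =[ a ]⇒ Δ
  combination-⇒ {s} c = record
    { countable = support-countable (p-nonNeg c) (p-sum≈1 c)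
    ; related   = proj₂ ∘ value
    ; left      = support-combination (constant-combination (p-nonNeg c) (p-sum≈1 c) (point s))
    ; right     = support-combination c
    }

  -- The meaning of `X[ Δ ]`.

  Rel⟨_⟩ : Env 1ℓ → Rel S 1ℓ
  Rel⟨ ρ ⟩ s t = point t ∈ ρ ⟨ X s ⟩ᵉ

  -- A distribution satisfying `↓ var (X x)` has only states related to `x` in its support, which is
  -- what coupling it with `point x` requires.
  X[]⇒Coupling : ∀ ρ → Θ ∈ ⟦ X[ Δ ] ⟧ ρ → Coupling Rel⟨ ρ ⟩ Δ Θ
  X[]⇒Coupling {Δ = Δ} ρ (Θs , c , h) =
    Coupling-mixture (support-combination (point-combination Δ)) c (λ x → Coupling-point⁺ (h x))

  Coupling⇒X[] : ∀ ρ → Coupling Rel⟨ ρ ⟩ Δ Θ → Θ ∈ ⟦ X[ Δ ] ⟧ ρ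
  Coupling⇒X[] {Δ = Δ} ρ w
    with Θs , c , ws ← Coupling-decompose (support-combination (point-combination Δ)) w
           -- The indices range over the support of `Δ`, so the case of weight zero is void.
           (λ { (x , [ 0<Δx ]) ≮ → contradiction (recompute em₀ 0<Δx) ≮ })
    = Θs , c , λ x → Coupling-point⁻ (ws x)

  equations-X : ∀ φ s → equations φ (X s) ≡ φ s
  equations-X φ s with Fin.any? (λ i → X (Inverse.from (proj₂ finite) i) ≟ⱽ X s)
  ... | yes (i , eq) = cong φ (X-injective eq)
  ... | no  ∄i = contradiction
    (Inverse.to (proj₂ finite) s , cong X (Inverse.strictlyInverseʳ (proj₂ finite) s)) ∄i

  -- From bisimulations to post-fixpoints.

  env : Rel S 1ℓ → Env 1ℓ
  env R = record
    -- Points are taken up to `≈ᴰ`, as environments must respect it. Variables other than the `X s`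
    -- denote the empty set, which makes their post-fixpoint condition vacuous.
    { _⟨_⟩ᵉ   = λ Y Θ → ∃₂ λ s t → X s ≡ Y × R s t × point t ≈ᴰ Θ
    ; resp-≈ᴰ = λ { Y Θ≈Θ′ (s , t , eq , r , t≈Θ) → s , t , eq , r , λ z → ≈-trans (t≈Θ z) (Θ≈Θ′ z) }
    }

  env-Rel : ∀ R → R s t → Rel⟨ env R ⟩ s t
  env-Rel R r = _ , _ , refl , r , λ _ → ≈-refl

  characteristic⁺ : IsBisimulation R → R s t → point t ∈ ⟦ characteristic s ⟧ (env R)
  -- The Boolean selects the conjunct: `true` the diamonds, `false` the boxes.
  characteristic⁺ {R} (sim , sim⁻¹) r true  (a , Δ , tr) =
    let Θ , t⇒Θ , l = sim r tr
    in  Θ , t⇒Θ , Coupling⇒X[] (env R) (Coupling-map (env-Rel R) (Lift⇒Coupling l))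
  characteristic⁺ {R} (sim , sim⁻¹) r false a Θ t⇒Θ =
    let p , c  = ⇒-combination t⇒Θ
        answer = λ k → sim⁻¹ r (proj₂ k)
        Δ , d  = mixture (p-nonNeg c) (p-sum≈1 c) (λ k → proj₁ (answer k))
        -- Each answer is itself a combined transition of `s`; flattening regroups their mixture `Δ`
        -- by single transitions of `s`.
        q , e  = flatten d (λ k → proj₂ (⇒-combination (proj₁ (proj₂ (answer k)))))
        w      = Coupling-mixture d c (λ k → Coupling-flip (Lift⇒Coupling (proj₂ (proj₂ (answer k)))))
        Θs , f , ws = Coupling-decompose e w
          -- The formula asks for a component at every transition of `s`, including those of weight
          -- zero. For these, the answer of `t` to the transition supplies a coupled distribution.
          (λ k _ → let Θ′ , _ , l = sim r (proj₂ k) in Θ′ , Lift⇒Coupling l)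
    in  q , Θs , f , λ k → Coupling⇒X[] (env R) (Coupling-map (env-Rel R) (ws k))

  env-postFixpoint : IsBisimulation R → IsPostFixpoint characteristicSystem (env R)
  env-postFixpoint {R} bis Y (s , t , refl , r , t≈Θ) =
    ⟦⟧-resp-≈ᴰ (characteristicSystem (X s)) (env R) t≈Θ
      (subst (λ φ → point t ∈ ⟦ φ ⟧ (env R)) (≡.sym (equations-X characteristic s))
        (characteristic⁺ bis r))

  -- From post-fixpoints to bisimulations.

  module _ {ρ : Env 1ℓ} (post : IsPostFixpoint characteristicSystem ρ) where

    characteristic⁻ : Rel⟨ ρ ⟩ s t → point t ∈ ⟦ characteristic s ⟧ ρ
    characteristic⁻ {s} {t} h =
      subst (λ φ → point t ∈ ⟦ φ ⟧ ρ) (equations-X characteristic s) (post (X s) h)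

    Rel-isBisimulation : IsBisimulation Rel⟨ ρ ⟩
    Rel-isBisimulation = forth , back
      where
      forth : IsSimulation Rel⟨ ρ ⟩
      forth h tr =
        let Θ , t⇒Θ , Θ∈ = characteristic⁻ h true (_ , _ , tr)
        in  Θ , t⇒Θ , Coupling⇒Lift (X[]⇒Coupling ρ Θ∈)
      back : IsSimulation (flip Rel⟨ ρ ⟩)
      back h tr =
        let p , Θs , c , Θs∈ = characteristic⁻ h false _ _ (step⇒ tr)
            -- The weights `p` that the box assigns to the transitions of `s` are applied to their
            -- targets; this mixture is the answer of `s`.
            Δ , d = mixture (p-nonNeg c) (p-sum≈1 c) proj₁
        in  Δ , combination-⇒ d
          , Coupling⇒Lift (Coupling-flip (Coupling-mixture d c (λ k → X[]⇒Coupling ρ (Θs∈ k))))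

  bisimilar⇔postFixpoint : ∀ s t → (∃[ R ] IsBisimulation R × R s t)
    ⇔ (∃[ ρ ] IsPostFixpoint characteristicSystem ρ × point t ∈ ρ ⟨ X s ⟩ᵉ)
  bisimilar⇔postFixpoint s t = mk⇔
    (λ { (R , bis , r) → env R , (λ Y → env-postFixpoint bis Y) , s , t , refl , r , λ _ → ≈-refl })
    (λ { (ρ , post , h) → Rel⟨ ρ ⟩ , Rel-isBisimulation post , h })

theorem2 :
    ExcludedMiddle 1ℓ →
    (ℝ : CompleteOrderedField) (L : PLTS ℝ) (V : Variables (PLTS.S L)) →
    let open PLTS L
        open Variables V
        open Bisimulation L
        open Logic L V
        E = characteristicSystem
    in
    (∀ s t → (∃[ R ] IsBisimulation R × R s t)
               ⇔ (∃[ ρ ] IsPostFixpoint E ρ × point t ∈ ρ ⟨ X s ⟩ᵉ))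
    × (∀ s → IsCharacteristicFor (ν E ⟨ X s ⟩ᵉ) s _∼_)
-- Both `s ∼ t` and membership in the union `ν E ⟨ X s ⟩ᵉ` unfold to the two sides of the first
-- claim, so the same proof serves the second.
theorem2 em ℝ L V = bisimilar⇔postFixpoint , bisimilar⇔postFixpoint
  where open Characteristic em L V
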